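{- Let $\mathcal{M}=(S,\mathit{Act},P)$ be an MDP, let $\mathsf{Init}\subseteq\Delta(S)$ be a set of initial distributions, let $\pi$ be a distributionally memoryless strategy in $\mathcal{M}$, and let $\varphi$ be a distributional $\omega$-regular specification over a finite set $\mathsf{AP}$ of atomic propositions, given by an NBA $N^\varphi=(Q,2^{\mathsf{AP}},\delta,q_0,F)$. Then $\mathcal{M}$ satisfies $\varphi$ under $\pi$ from every initial distribution $\mu_0\in\mathsf{Init}$ if and only if there exists a distributional certificate $(\mathcal{C},I)$ for $\mathcal{M}$, $\mathsf{Init}$, $\pi$ and $\varphi$.
   Context: **MDPs.** $\Delta(X)$ is the set of probability distributions over a countable set $X$. A Markov decision process (MDP) $\mathcal{M}=(S,\mathit{Act},P)$ has a finite set $S=\{s_1,\dots,s_{|S|}\}$ of states (with a fixed enumeration), a finite set $\mathit{Act}$ of actions, a set $\mathit{Act}(s)\subseteq\mathit{Act}$ of available actions for each $s\in S$, and a transition function $P$ assigning to each $s\in S$ and $a\in\mathit{Act}(s)$ a distribution $P(s,a)\in\Delta(S)$. **Distributionally memoryless strategies.** A strategy maps each finite path (history) to a distribution over actions available at its last state. It is distributionally memoryless if this distribution depends only on the current state and on the current distribution over MDP states, not on the rest of the history. It is thus given by numbers $\pi(s,a)(\mu)\ge 0$, for $s\in S$, $a\in\mathit{Act}(s)$, $\mu\in\Delta(S)$, with $\sum_{a\in\mathit{Act}(s)}\pi(s,a)(\mu)=1$. The single-step distribution transformer $\mathcal{M}^\pi:\Delta(S)\to\Delta(S)$ is $$\mathcal{M}^\pi(\mu)=\sum_{s\in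 S}\sum_{a\in\mathit{Act}(s)}\mu(s)\,\pi(s,a)(\mu)\,P(s,a).$$ From $\mu_0\in\Delta(S)$, $\mathcal{M}$ under $\pi$ induces the sequence of distributions $\mu_0,\mu_1,\mu_2,\dots$ with $\mu_{i+1}=\mathcal{M}^\pi(\mu_i)$ ($\mu_i(s)$ is the probability that the random path is in state $s$ at time $i$). **Distributional $\omega$-regular specifications.** $\mathsf{AP}$ is a finite set of formulas of the form $\mathsf{exp}(\mu(s_1),\dots,\mu(s_{|S|}))\ge 0$, where $\mathsf{exp}:\mathbb{R}^{|S|}\to\mathbb{R}$ is an arithmetic expression; $\mu\models p$ means that $p$ holds at $\mu$. A distributional $\omega$-regular specification $\varphi$ is given by a nondeterministic Büchi automaton (NBA) $N^\varphi=(Q,2^{\mathsf{AP}},\delta,q_0,F)$ with finite state set $Q$, transition function $\delta:Q\times 2^{\mathsf{AP}}\to 2^Q$, initial state $q_0\in Q$ and accepting states $F\subseteq Q$. An infinite word $\sigma_0,\sigma_1,\dots$ over $2^{\mathsf{AP}}$ is accepted if there is a run starting in the initial state, $q_0,q_1,q_2,\dots$, with $q_{i+1}\in\delta(q_i,\sigma_i)$ for all $i\geq 0$ and $q_i\in F$ for infinitely many $i$. $\mathcal{M}$ satisfies $\varphi$ under $\pi$ from $\mu_0$ if the word $\sigma_0,\sigma_1,\dots$ with $\sigma_i=\{p\in\mathsf{AP}\mid\mu_i\models p\}$ is accepted by $N^\varphi$. **Distributional certificates.** For $\sigma\in 2^{\mathsf{AP}}$, write $\mu\models G(\sigma)$ for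 $\mu\models\bigwedge_{p\in\sigma}p\wedge\bigwedge_{p\in\mathsf{AP}\setminus\sigma}\neg p$. A distributional certificate for $\mathcal{M}$, $\mathsf{Init}$, $\pi$ and $\varphi$ (with NBA $N^\varphi$) is a pair $(\mathcal{C},I)$ of a function $\mathcal{C}:Q\times\Delta(S)\to\mathbb{R}$ and a set $I\subseteq Q\times\Delta(S)$ such that: - (Initial condition) for all $\mu_0\in\mathsf{Init}$, $\mathcal{C}(q_0,\mu_0)\ge 0$ and $(q_0,\mu_0)\in I$, where $q_0$ is the initial state of the NBA; - (Büchi ranking condition, accepting states) for all $q\in F$, $\sigma\in 2^{\mathsf{AP}}$ and $\mu\in\Delta(S)$ with $\mu\models G(\sigma)$, $\mathcal{C}(q,\mu)\ge 0$ and $(q,\mu)\in I$, there exists $q'\in\delta(q,\sigma)$ with $\mathcal{C}(q',\mathcal{M}^\pi(\mu))\ge 0$ and $(q',\mathcal{M}^\pi(\mu))\in I$; - (Büchi ranking condition, non-accepting states) for all $q\in Q\setminus F$, $\sigma\in 2^{\mathsf{AP}}$ and $\mu\in\Delta(S)$ with $\mu\models G(\sigma)$, $\mathcal{C}(q,\mu)\ge 0$ and $(q,\mu)\in I$, there exists $q'\in\delta(q,\sigma)$ with $\mathcal{C}(q,\mu)-1\ge\mathcal{C}(q',\mathcal{M}^\pi(\mu))\ge 0$ and $(q',\mathcal{M}^\pi(\mu))\in I$. -}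

module Defs where

open import Algebra.Bundles using (CommutativeRing)
open import Algebra.Structures using (IsCommutativeRing)
open import Axiom.ExcludedMiddle using (ExcludedMiddle)
open import Data.Fin.Base using (Fin; zero; suc)
open import Data.Fin.Subset using (Subset; _∈_; _∉_)
open import Data.Fin.Subset.Properties using (_∈?_)
open import Data.Nat.Base as ℕ using (ℕ; zero; suc)
import Data.Nat.Properties as ℕ
open import Data.Product.Base using (Σ-syntax; ∃-syntax; _×_; _,_; proj₁; proj₂)
open import Data.Product.Relation.Binary.Pointwise.NonDependent using (×-setoid)
open import Data.Rational.Base as ℚ using (ℚ; 0ℚ; 1ℚ; ½; ∣_∣)
import Data.Rational.Properties as ℚ
open import Data.Rational.Solver using (module +-*-Solver)
open import Data.Sum.Base using (inj₁; inj₂)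
open import Data.Vec.Base using (tabulate)
open import Data.Vec.Functional using (Vector)
import Data.Vec.Functional.Relation.Binary.Equality.Setoid as Equality
open import Function.Base using (id; _∘_)
open import Function.Bundles using (Func)
open import Level using (0ℓ)
open import Relation.Binary.Bundles using (Setoid)
import Relation.Binary.Construct.On as On
open import Relation.Binary.Core using (Rel)
open import Relation.Binary.Definitions using (_Respects_)
open import Relation.Binary.PropositionalEquality as ≡ using (_≡_; refl)
open import Relation.Binary.Structures using (IsEquivalence)
open import Relation.Nullary using (¬_; yes; no; does; contradiction)
open import Relation.Unary using (Pred)

open +-*-Solver using (solve; con; _:+_; _:*_; _:-_; :-_; _:=_)

-- The tails of the index set A are { a ∣ N ≤ depth a }; A is ℕ or ℕ × ℕ below.

Eventually : {A : Set} (depth : A → ℕ) → Pred A 0ℓ → Set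
Eventually depth P = ∃[ N ] (∀ a → N ℕ.≤ depth a → P a)

Vanishing : {A : Set} (depth : A → ℕ) → (A → ℚ) → Set
Vanishing depth f = ∀ ε → 0ℚ ℚ.< ε → Eventually depth (λ a → ∣ f a ∣ ℚ.< ε)

EventuallyBounded : {A : Set} (depth : A → ℕ) → (A → ℚ) → Set
EventuallyBounded depth f = ∃[ B ] (0ℚ ℚ.< B × Eventually depth (λ a → ∣ f a ∣ ℚ.≤ B))

depth₂ : ℕ × ℕ → ℕ
depth₂ (m , n) = m ℕ.⊓ n

record ℝ : Set where
  no-eta-equality
  field
    seq    : ℕ → ℚ
    cauchy : Vanishing depth₂ (λ (m , n) → seq m ℚ.- seq n)

open ℝ public

infix 4 _≈_ _≤_ _#0

record _≈_ (x y : ℝ) : Set where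
  constructor mk≈
  field un≈ : Vanishing id (λ n → seq x n ℚ.- seq y n)

record _≤_ (x y : ℝ) : Set where
  constructor mk≤
  field un≤ : ∀ ε → 0ℚ ℚ.< ε → Eventually id (λ n → seq x n ℚ.- seq y n ℚ.< ε)

open _≈_ public
open _≤_ public

-- Apartness from zero; under excluded middle it is equivalent to ¬ (x ≈ 0).
_#0 : Pred ℝ 0ℓ
x #0 = ∃[ ε ] (0ℚ ℚ.< ε × Eventually id (λ n → ε ℚ.≤ ∣ seq x n ∣))

0<1 : 0ℚ ℚ.< 1ℚ
0<1 = ℚ.positive⁻¹ 1ℚ

*-pos : ∀ {p q} → 0ℚ ℚ.< p → 0ℚ ℚ.< q → 0ℚ ℚ.< p ℚ.* q
*-pos {p} {q} 0<p 0<q =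
  ℚ.positive⁻¹ (p ℚ.* q) {{ℚ.pos*pos⇒pos p {{ℚ.positive 0<p}} q {{ℚ.positive 0<q}}}}

half-pos : ∀ {ε} → 0ℚ ℚ.< ε → 0ℚ ℚ.< ε ℚ.* ½
half-pos 0<ε = *-pos 0<ε (ℚ.positive⁻¹ ½)

halves : ∀ ε → ε ℚ.* ½ ℚ.+ ε ℚ.* ½ ≡ ε
halves = solve 1 (λ ε → ε :* con ½ :+ ε :* con ½ := ε) refl

quotient : ∀ {ε B} → 0ℚ ℚ.< ε → 0ℚ ℚ.< B → ∃[ δ ] (0ℚ ℚ.< δ × B ℚ.* δ ≡ ε)
quotient {ε} {B} 0<ε 0<B = ℚ.1/ B ℚ.* ε , *-pos 0<1/B 0<ε , eq
  where
  instance
    B-pos = ℚ.positive 0<B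
    B≢0   = ℚ.pos⇒nonZero B
  0<1/B : 0ℚ ℚ.< ℚ.1/ B
  0<1/B = ℚ.positive⁻¹ (ℚ.1/ B) {{ℚ.1/pos⇒pos B}}
  eq : B ℚ.* (ℚ.1/ B ℚ.* ε) ≡ ε
  eq = ≡.trans (≡.sym (ℚ.*-assoc B (ℚ.1/ B) ε))
         (≡.trans (≡.cong (ℚ._* ε) (ℚ.*-inverseʳ B)) (ℚ.*-identityˡ ε))

p≤∣p∣ : ∀ p → p ℚ.≤ ∣ p ∣
p≤∣p∣ p with ℚ.≤-total 0ℚ p
... | inj₁ 0≤p = ℚ.≤-reflexive (≡.sym (ℚ.0≤p⇒∣p∣≡p 0≤p))
... | inj₂ p≤0 = ℚ.≤-trans p≤0 (ℚ.0≤∣p∣ p)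

∣*∣-mono : ∀ {p q a b} → 0ℚ ℚ.≤ b → ∣ p ∣ ℚ.≤ a → ∣ q ∣ ℚ.≤ b → ∣ p ℚ.* q ∣ ℚ.≤ a ℚ.* b
∣*∣-mono {p} {q} {a} {b} 0≤b p≤a q≤b = begin
  ∣ p ℚ.* q ∣      ≡⟨ ℚ.∣p*q∣≡∣p∣*∣q∣ p q ⟩
  ∣ p ∣ ℚ.* ∣ q ∣  ≤⟨ ℚ.*-monoˡ-≤-nonNeg ∣ p ∣ {{ℚ.∣-∣-nonNeg p}} q≤b ⟩
  ∣ p ∣ ℚ.* b      ≤⟨ ℚ.*-monoʳ-≤-nonNeg b {{ℚ.nonNegative 0≤b}} p≤a ⟩
  a ℚ.* b          ∎
  where open ℚ.≤-Reasoning

module _ {A : Set} {depth : A → ℕ} where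

  always : {P : Pred A 0ℓ} → (∀ a → P a) → Eventually depth P
  always p = 0 , λ a _ → p a

  both : {P Q R : Pred A 0ℓ} → (∀ {a} → P a → Q a → R a) →
         Eventually depth P → Eventually depth Q → Eventually depth R
  both f (M , p) (N , q) = M ℕ.⊔ N , λ a h →
    f (p a (ℕ.≤-trans (ℕ.m≤m⊔n M N) h)) (q a (ℕ.≤-trans (ℕ.m≤n⊔m M N) h))

  eventually-map : {P Q : Pred A 0ℓ} → (∀ {a} → P a → Q a) →
                   Eventually depth P → Eventually depth Q
  eventually-map f (N , p) = N , λ a h → f (p a h)

  reindex : {B : Set} {depth′ : B → ℕ} {P : Pred A 0ℓ} (h : B → A) →
            (∀ b → depth′ b ℕ.≤ depth (h b)) →
            Eventually depth P → Eventually depth′ (P ∘ h)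
  reindex h le (N , p) = N , λ b k → p (h b) (ℕ.≤-trans k (le b))

  vanishing-resp : ∀ {f g} → Eventually depth (λ a → f a ≡ g a) →
                   Vanishing depth f → Vanishing depth g
  vanishing-resp eq v ε 0<ε = both (≡.subst (λ p → ∣ p ∣ ℚ.< ε)) eq (v ε 0<ε)

  vanishing-0 : ∀ {f} → Eventually depth (λ a → f a ≡ 0ℚ) → Vanishing depth f
  vanishing-0 eq ε 0<ε = eventually-map (λ e → ≡.subst (λ p → ∣ p ∣ ℚ.< ε) (≡.sym e) 0<ε) eq

  vanishing-+ : ∀ {f g} → Vanishing depth f → Vanishing depth g →
                Vanishing depth (λ a → f a ℚ.+ g a)
  vanishing-+ {f} {g} v w ε 0<ε =
    both (λ {a} p q → ℚ.≤-<-trans (ℚ.∣p+q∣≤∣p∣+∣q∣ (f a) (g a))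
                        (≡.subst (_ ℚ.<_) (halves ε) (ℚ.+-mono-< p q)))
         (v (ε ℚ.* ½) (half-pos 0<ε)) (w (ε ℚ.* ½) (half-pos 0<ε))

  vanishing-neg : ∀ {f} → Vanishing depth f → Vanishing depth (λ a → ℚ.- f a)
  vanishing-neg {f} v ε 0<ε =
    eventually-map (λ {a} → ≡.subst (ℚ._< ε) (≡.sym (ℚ.∣-p∣≡∣p∣ (f a)))) (v ε 0<ε)

  vanishing-* : ∀ {f g} → EventuallyBounded depth f → Vanishing depth g →
                Vanishing depth (λ a → f a ℚ.* g a)
  vanishing-* {f} {g} (B , 0<B , bound) v ε 0<ε =
    let (δ , 0<δ , Bδ≡) = quotient (half-pos 0<ε) 0<B
    in both (λ p q → ℚ.≤-<-trans
                (ℚ.≤-trans (∣*∣-mono (ℚ.<⇒≤ 0<δ) p (ℚ.<⇒≤ q)) (ℚ.≤-reflexive Bδ≡))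
                half<)
            bound (v δ 0<δ)
    where
    half< : ε ℚ.* ½ ℚ.< ε
    half< = ≡.subst₂ ℚ._<_ (ℚ.+-identityʳ _) (halves ε) (ℚ.+-monoʳ-< (ε ℚ.* ½) (half-pos 0<ε))

  bounded-* : ∀ {f g} → EventuallyBounded depth f → EventuallyBounded depth g →
              EventuallyBounded depth (λ a → f a ℚ.* g a)
  bounded-* (B , 0<B , b) (C , 0<C , c) =
    B ℚ.* C , *-pos 0<B 0<C , both (∣*∣-mono (ℚ.<⇒≤ 0<C)) b c

bounded-reindex : {A B : Set} {depth : A → ℕ} {depth′ : B → ℕ} {f : A → ℚ} (h : B → A) →
                  (∀ b → depth′ b ℕ.≤ depth (h b)) →
                  EventuallyBounded depth f → EventuallyBounded depth′ (f ∘ h)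
bounded-reindex h le (B , 0<B , b) = B , 0<B , reindex h le b

π₁≥ : ∀ mn → depth₂ mn ℕ.≤ proj₁ mn
π₁≥ (m , n) = ℕ.m⊓n≤m m n

π₂≥ : ∀ mn → depth₂ mn ℕ.≤ proj₂ mn
π₂≥ (m , n) = ℕ.m⊓n≤n m n

seq-bounded : ∀ x → EventuallyBounded id (seq x)
seq-bounded x = B , 0<B , N , λ n N≤n → begin
    ∣ seq x n ∣                                  ≡⟨ ≡.cong ∣_∣ (split (seq x n) (seq x N)) ⟩
    ∣ seq x N ℚ.+ (seq x n ℚ.- seq x N) ∣        ≤⟨ ℚ.∣p+q∣≤∣p∣+∣q∣ (seq x N) _ ⟩
    ∣ seq x N ∣ ℚ.+ ∣ seq x n ℚ.- seq x N ∣      ≤⟨ ℚ.+-monoʳ-≤ ∣ seq x N ∣ (ℚ.<⇒≤ (near n N≤n)) ⟩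
    B                                            ∎
  where
  open ℚ.≤-Reasoning
  N = proj₁ (cauchy x 1ℚ 0<1)
  near : ∀ n → N ℕ.≤ n → ∣ seq x n ℚ.- seq x N ∣ ℚ.< 1ℚ
  near n N≤n = proj₂ (cauchy x 1ℚ 0<1) (n , N) (ℕ.⊓-glb N≤n ℕ.≤-refl)
  B = ∣ seq x N ∣ ℚ.+ 1ℚ
  0<B : 0ℚ ℚ.< B
  0<B = ℚ.+-mono-≤-< (ℚ.0≤∣p∣ (seq x N)) 0<1
  split : ∀ p q → p ≡ q ℚ.+ (p ℚ.- q)
  split = solve 2 (λ p q → p := q :+ (p :- q)) refl

flip-diff : ∀ p q → ℚ.- (p ℚ.- q) ≡ q ℚ.- p
flip-diff = solve 2 (λ p q → :- (p :- q) := q :- p) refl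

+-diff : ∀ x y x′ y′ → (x ℚ.- x′) ℚ.+ (y ℚ.- y′) ≡ (x ℚ.+ y) ℚ.- (x′ ℚ.+ y′)
+-diff = solve 4 (λ x y x′ y′ → (x :- x′) :+ (y :- y′) := (x :+ y) :- (x′ :+ y′)) refl

neg-diff : ∀ x x′ → ℚ.- (x ℚ.- x′) ≡ (ℚ.- x) ℚ.- (ℚ.- x′)
neg-diff = solve 2 (λ x x′ → :- (x :- x′) := (:- x) :- (:- x′)) refl

*-diff : ∀ x y x′ y′ → y ℚ.* (x ℚ.- x′) ℚ.+ x′ ℚ.* (y ℚ.- y′) ≡ x ℚ.* y ℚ.- x′ ℚ.* y′
*-diff = solve 4 (λ x y x′ y′ → y :* (x :- x′) :+ x′ :* (y :- y′) := x :* y :- x′ :* y′) refl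

infixl 6 _+_ _-_
infixl 7 _*_
infix  8 -_

fromℚ : ℚ → ℝ
fromℚ p .seq _ = p
fromℚ p .cauchy = vanishing-0 (always λ _ → ℚ.+-inverseʳ p)

0ℝ 1ℝ : ℝ
0ℝ = fromℚ 0ℚ
1ℝ = fromℚ 1ℚ

_+_ : ℝ → ℝ → ℝ
(x + y) .seq n = seq x n ℚ.+ seq y n
(x + y) .cauchy =
  vanishing-resp (always λ (m , n) → +-diff (seq x m) (seq y m) (seq x n) (seq y n))
    (vanishing-+ (cauchy x) (cauchy y))

-_ : ℝ → ℝ
(- x) .seq n = ℚ.- seq x n
(- x) .cauchy =
  vanishing-resp (always λ (m , n) → neg-diff (seq x m) (seq x n)) (vanishing-neg (cauchy x))

_-_ : ℝ → ℝ → ℝ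
x - y = x + - y

_*_ : ℝ → ℝ → ℝ
(x * y) .seq n = seq x n ℚ.* seq y n
(x * y) .cauchy =
  vanishing-resp (always λ (m , n) → *-diff (seq x m) (seq y m) (seq x n) (seq y n))
    (vanishing-+ (vanishing-* (bounded-reindex proj₁ π₁≥ (seq-bounded y)) (cauchy x))
                 (vanishing-* (bounded-reindex proj₂ π₂≥ (seq-bounded x)) (cauchy y)))

recip : ℚ → ℚ
recip p with p ℚ.≟ 0ℚ
... | yes _  = 0ℚ
... | no p≢0 = (ℚ.1/ p) {{ℚ.≢-nonZero p≢0}}

-- Only finitely many terms of a sequence apart from zero can vanish, so
-- recip 0ℚ is irrelevant to the real number defined below.
recip-inverse : ∀ {δ p} → 0ℚ ℚ.< δ → δ ℚ.≤ ∣ p ∣ → recip p ℚ.* p ≡ 1ℚ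
recip-inverse {δ} {p} 0<δ δ≤ with p ℚ.≟ 0ℚ
... | yes refl = contradiction refl (ℚ.<⇒≢ (ℚ.<-≤-trans 0<δ δ≤))
... | no p≢0   = ℚ.*-inverseˡ p {{ℚ.≢-nonZero p≢0}}

recip-bound : ∀ {δ B p} → 0ℚ ℚ.< δ → δ ℚ.* B ≡ 1ℚ → δ ℚ.≤ ∣ p ∣ → ∣ recip p ∣ ℚ.≤ B
recip-bound {δ} {B} {p} 0<δ δB≡1 δ≤ = ℚ.*-cancelʳ-≤-pos δ {{ℚ.positive 0<δ}} (begin
  ∣ recip p ∣ ℚ.* δ      ≤⟨ ℚ.*-monoˡ-≤-nonNeg ∣ recip p ∣ {{ℚ.∣-∣-nonNeg (recip p)}} δ≤ ⟩
  ∣ recip p ∣ ℚ.* ∣ p ∣  ≡⟨ ℚ.∣p*q∣≡∣p∣*∣q∣ (recip p) p ⟨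
  ∣ recip p ℚ.* p ∣      ≡⟨ ≡.cong ∣_∣ (recip-inverse 0<δ δ≤) ⟩
  1ℚ                     ≡⟨ δB≡1 ⟨
  δ ℚ.* B                ≡⟨ ℚ.*-comm δ B ⟩
  B ℚ.* δ                ∎)
  where open ℚ.≤-Reasoning

recip-diff : ∀ p q → recip p ℚ.* p ≡ 1ℚ → recip q ℚ.* q ≡ 1ℚ →
             (recip p ℚ.* recip q) ℚ.* (q ℚ.- p) ≡ recip p ℚ.- recip q
recip-diff p q rp≡1 sq≡1 = begin
  (r ℚ.* s) ℚ.* (q ℚ.- p)              ≡⟨ expand p q r s ⟩
  r ℚ.* (s ℚ.* q) ℚ.- s ℚ.* (r ℚ.* p)  ≡⟨ ≡.cong₂ (λ a b → r ℚ.* a ℚ.- s ℚ.* b) sq≡1 rp≡1 ⟩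
  r ℚ.* 1ℚ ℚ.- s ℚ.* 1ℚ                ≡⟨ ≡.cong₂ ℚ._-_ (ℚ.*-identityʳ r) (ℚ.*-identityʳ s) ⟩
  r ℚ.- s                              ∎
  where
  open ≡.≡-Reasoning
  r = recip p
  s = recip q
  expand : ∀ p q r s → (r ℚ.* s) ℚ.* (q ℚ.- p) ≡ r ℚ.* (s ℚ.* q) ℚ.- s ℚ.* (r ℚ.* p)
  expand = solve 4 (λ p q r s → (r :* s) :* (q :- p) := r :* (s :* q) :- s :* (r :* p)) refl

inverse : (x : ℝ) → x #0 → ℝ
inverse x _ .seq n = recip (seq x n)
inverse x (δ , 0<δ , away) .cauchy = vanishing-resp
  (both (λ {(m , n)} → recip-diff (seq x m) (seq x n)) (reindex proj₁ π₁≥ inv) (reindex proj₂ π₂≥ inv))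
  (vanishing-* (bounded-* (bounded-reindex proj₁ π₁≥ bound) (bounded-reindex proj₂ π₂≥ bound))
    (vanishing-resp (always λ (m , n) → flip-diff (seq x m) (seq x n))
      (vanishing-neg (cauchy x))))
  where
  inv : Eventually id (λ n → recip (seq x n) ℚ.* seq x n ≡ 1ℚ)
  inv = eventually-map (recip-inverse 0<δ) away
  bound : EventuallyBounded id (λ n → recip (seq x n))
  bound = let (B , 0<B , δB≡1) = quotient 0<1 0<δ
          in B , 0<B , eventually-map (recip-bound 0<δ δB≡1) away

pointwise : ∀ {x y} → (∀ n → seq x n ≡ seq y n) → x ≈ y
pointwise {x} {y} eq =
  mk≈ (vanishing-0 (always λ n → ≡.trans (≡.cong (ℚ._- seq y n) (eq n)) (ℚ.+-inverseʳ (seq y n))))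

telescope : ∀ x y z → (x ℚ.- y) ℚ.+ (y ℚ.- z) ≡ x ℚ.- z
telescope = solve 3 (λ x y z → (x :- y) :+ (y :- z) := x :- z) refl

≈-isEquivalence : IsEquivalence _≈_
≈-isEquivalence = record
  { refl  = pointwise (λ _ → refl)
  ; sym   = λ {x} {y} (mk≈ v) →
      mk≈ (vanishing-resp (always λ n → flip-diff (seq x n) (seq y n)) (vanishing-neg v))
  ; trans = λ {x} {y} {z} (mk≈ v) (mk≈ w) →
      mk≈ (vanishing-resp (always λ n → telescope (seq x n) (seq y n) (seq z n)) (vanishing-+ v w))
  }

+-cong : ∀ {x x′ y y′} → x ≈ x′ → y ≈ y′ → x + y ≈ x′ + y′
+-cong {x} {x′} {y} {y′} (mk≈ v) (mk≈ w) = mk≈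
  (vanishing-resp (always λ n → +-diff (seq x n) (seq y n) (seq x′ n) (seq y′ n)) (vanishing-+ v w))

neg-cong : ∀ {x x′} → x ≈ x′ → - x ≈ - x′
neg-cong {x} {x′} (mk≈ v) = mk≈
  (vanishing-resp (always λ n → neg-diff (seq x n) (seq x′ n)) (vanishing-neg v))

*-cong : ∀ {x x′ y y′} → x ≈ x′ → y ≈ y′ → x * y ≈ x′ * y′
*-cong {x} {x′} {y} {y′} (mk≈ v) (mk≈ w) = mk≈
  (vanishing-resp (always λ n → *-diff (seq x n) (seq y n) (seq x′ n) (seq y′ n))
    (vanishing-+ (vanishing-* (seq-bounded y) v) (vanishing-* (seq-bounded x′) w)))

+-*-isCommutativeRing : IsCommutativeRing _≈_ _+_ _*_ -_ 0ℝ 1ℝ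
+-*-isCommutativeRing = record
  { isRing = record
    { +-isAbelianGroup = record
      { isGroup = record
        { isMonoid = record
          { isSemigroup = record
            { isMagma = record { isEquivalence = ≈-isEquivalence ; ∙-cong = +-cong }
            ; assoc   = λ x y z → pointwise (λ n → ℚ.+-assoc (seq x n) (seq y n) (seq z n))
            }
          ; identity = (λ x → pointwise (λ n → ℚ.+-identityˡ (seq x n)))
                     , (λ x → pointwise (λ n → ℚ.+-identityʳ (seq x n)))
          }
        ; inverse = (λ x → pointwise (λ n → ℚ.+-inverseˡ (seq x n)))
                  , (λ x → pointwise (λ n → ℚ.+-inverseʳ (seq x n)))
        ; ⁻¹-cong = neg-cong
        }
      ; comm = λ x y → pointwise (λ n → ℚ.+-comm (seq x n) (seq y n))
      }
    ; *-cong     = *-cong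
    ; *-assoc    = λ x y z → pointwise (λ n → ℚ.*-assoc (seq x n) (seq y n) (seq z n))
    ; *-identity = (λ x → pointwise (λ n → ℚ.*-identityˡ (seq x n)))
                 , (λ x → pointwise (λ n → ℚ.*-identityʳ (seq x n)))
    ; distrib    = (λ x y z → pointwise (λ n → ℚ.*-distribˡ-+ (seq x n) (seq y n) (seq z n)))
                 , (λ x y z → pointwise (λ n → ℚ.*-distribʳ-+ (seq x n) (seq y n) (seq z n)))
    }
  ; *-comm = λ x y → pointwise (λ n → ℚ.*-comm (seq x n) (seq y n))
  }

ℝ-commutativeRing : CommutativeRing 0ℓ 0ℓ
ℝ-commutativeRing = record { isCommutativeRing = +-*-isCommutativeRing }

open CommutativeRing ℝ-commutativeRing public
  using () renaming (setoid to ℝ-setoid)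

open import Algebra.Properties.Semiring.Sum (CommutativeRing.semiring ℝ-commutativeRing)
  using (sum; sum-syntax; sum-cong-≋; sum-replicate-zero; ∑-comm; *-distribˡ-sum)

private
  module R = CommutativeRing ℝ-commutativeRing

≈⇒≤ : ∀ {x y} → x ≈ y → x ≤ y
≈⇒≤ {x} {y} (mk≈ v) = mk≤ λ ε 0<ε →
  eventually-map (λ {n} → ℚ.≤-<-trans (p≤∣p∣ (seq x n ℚ.- seq y n))) (v ε 0<ε)

≤-trans : ∀ {x y z} → x ≤ y → y ≤ z → x ≤ z
≤-trans {x} {y} {z} (mk≤ v) (mk≤ w) = mk≤ λ ε 0<ε →
  both (λ {n} p q → ≡.subst₂ ℚ._<_ (telescope (seq x n) (seq y n) (seq z n)) (halves ε)
                      (ℚ.+-mono-< p q))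
       (v (ε ℚ.* ½) (half-pos 0<ε)) (w (ε ℚ.* ½) (half-pos 0<ε))

+-mono-≤ : ∀ {x x′ y y′} → x ≤ x′ → y ≤ y′ → x + y ≤ x′ + y′
+-mono-≤ {x} {x′} {y} {y′} (mk≤ v) (mk≤ w) = mk≤ λ ε 0<ε →
  both (λ {n} p q → ≡.subst₂ ℚ._<_ (+-diff (seq x n) (seq y n) (seq x′ n) (seq y′ n)) (halves ε)
                      (ℚ.+-mono-< p q))
       (v (ε ℚ.* ½) (half-pos 0<ε)) (w (ε ℚ.* ½) (half-pos 0<ε))

-- If p , q > - δ and ∣ p ∣ , ∣ q ∣ ≤ B , C then p q > - ε whenever B δ , C δ < ε.
*-lower : ∀ {p q B C δ ε} → 0ℚ ℚ.< δ → 0ℚ ℚ.< ε → B ℚ.* δ ℚ.< ε → C ℚ.* δ ℚ.< ε →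
          0ℚ ℚ.- p ℚ.< δ → 0ℚ ℚ.- q ℚ.< δ → ∣ p ∣ ℚ.≤ B → ∣ q ∣ ℚ.≤ C →
          0ℚ ℚ.- p ℚ.* q ℚ.< ε
*-lower {p} {q} {B} {C} {δ} {ε} 0<δ 0<ε Bδ<ε Cδ<ε -p<δ -q<δ ∣p∣≤B ∣q∣≤C
  with ℚ.≤-total 0ℚ p | ℚ.≤-total 0ℚ q
... | inj₁ 0≤p | inj₁ 0≤q =
  ℚ.≤-<-trans (≡.subst (ℚ._≤ 0ℚ) (≡.sym (ℚ.+-identityˡ _))
                 (ℚ.neg-antimono-≤ (ℚ.nonNegative⁻¹ (p ℚ.* q)
                   {{ℚ.nonNeg*nonNeg⇒nonNeg p {{ℚ.nonNegative 0≤p}} q {{ℚ.nonNegative 0≤q}}}})))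
              0<ε
... | inj₂ p≤0 | inj₂ q≤0 =
  ℚ.≤-<-trans (≡.subst (ℚ._≤ 0ℚ) (≡.sym (ℚ.+-identityˡ _))
                 (ℚ.neg-antimono-≤ (≡.subst (0ℚ ℚ.≤_) (neg-neg p q)
                   (ℚ.nonNegative⁻¹ ((ℚ.- p) ℚ.* (ℚ.- q))
                     {{ℚ.nonNeg*nonNeg⇒nonNeg (ℚ.- p) {{ℚ.nonNegative (ℚ.neg-antimono-≤ p≤0)}}
                         (ℚ.- q) {{ℚ.nonNegative (ℚ.neg-antimono-≤ q≤0)}}}}))))
              0<ε
  where
  neg-neg : ∀ p q → (ℚ.- p) ℚ.* (ℚ.- q) ≡ p ℚ.* q
  neg-neg = solve 2 (λ p q → (:- p) :* (:- q) := p :* q) refl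
... | inj₁ 0≤p | inj₂ q≤0 = ℚ.≤-<-trans (begin
    0ℚ ℚ.- p ℚ.* q    ≡⟨ shift p q ⟩
    p ℚ.* (0ℚ ℚ.- q)  ≤⟨ ℚ.*-monoˡ-≤-nonNeg p {{ℚ.nonNegative 0≤p}} (ℚ.<⇒≤ -q<δ) ⟩
    p ℚ.* δ           ≤⟨ ℚ.*-monoʳ-≤-nonNeg δ {{ℚ.nonNegative (ℚ.<⇒≤ 0<δ)}}
                           (ℚ.≤-trans (p≤∣p∣ p) ∣p∣≤B) ⟩
    B ℚ.* δ           ∎) Bδ<ε
  where
  open ℚ.≤-Reasoning
  shift : ∀ p q → 0ℚ ℚ.- p ℚ.* q ≡ p ℚ.* (0ℚ ℚ.- q)
  shift = solve 2 (λ p q → con 0ℚ :- p :* q := p :* (con 0ℚ :- q)) refl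
... | inj₂ p≤0 | inj₁ 0≤q = ℚ.≤-<-trans (begin
    0ℚ ℚ.- p ℚ.* q    ≡⟨ shift p q ⟩
    q ℚ.* (0ℚ ℚ.- p)  ≤⟨ ℚ.*-monoˡ-≤-nonNeg q {{ℚ.nonNegative 0≤q}} (ℚ.<⇒≤ -p<δ) ⟩
    q ℚ.* δ           ≤⟨ ℚ.*-monoʳ-≤-nonNeg δ {{ℚ.nonNegative (ℚ.<⇒≤ 0<δ)}}
                           (ℚ.≤-trans (p≤∣p∣ q) ∣q∣≤C) ⟩
    C ℚ.* δ           ∎) Cδ<ε
  where
  open ℚ.≤-Reasoning
  shift : ∀ p q → 0ℚ ℚ.- p ℚ.* q ≡ q ℚ.* (0ℚ ℚ.- p)
  shift = solve 2 (λ p q → con 0ℚ :- p :* q := q :* (con 0ℚ :- p)) refl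

0≤* : ∀ {x y} → 0ℝ ≤ x → 0ℝ ≤ y → 0ℝ ≤ x * y
0≤* {x} {y} (mk≤ 0≤x) (mk≤ 0≤y) = mk≤ λ ε 0<ε →
  let (B , 0<B , xB) = seq-bounded x
      (C , 0<C , yC) = seq-bounded y
      0<B+C          = ℚ.+-mono-< 0<B 0<C
      (δ , 0<δ , eq) = quotient 0<ε 0<B+C
      scaled : ∀ {D} → D ℚ.< B ℚ.+ C → D ℚ.* δ ℚ.< ε
      scaled {D} lt  = ≡.subst (D ℚ.* δ ℚ.<_) eq (ℚ.*-monoˡ-<-pos δ {{ℚ.positive 0<δ}} lt)
      B<             = ≡.subst (ℚ._< B ℚ.+ C) (ℚ.+-identityʳ B) (ℚ.+-monoʳ-< B 0<C)
      C<             = ≡.subst (ℚ._< B ℚ.+ C) (ℚ.+-identityˡ C) (ℚ.+-monoˡ-< C 0<B)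
  in both (λ (p , q) (r , s) → *-lower 0<δ 0<ε (scaled B<) (scaled C<) p q r s)
          (both _,_ (0≤x δ 0<δ) (0≤y δ 0<δ)) (both _,_ xB yC)

0≤sum : ∀ {n} (f : Vector ℝ n) → (∀ i → 0ℝ ≤ f i) → 0ℝ ≤ sum f
0≤sum {zero}  f 0≤f = ≈⇒≤ R.refl
0≤sum {suc n} f 0≤f = ≤-trans (≈⇒≤ (R.sym (R.+-identityˡ 0ℝ)))
                              (+-mono-≤ (0≤f zero) (0≤sum (f ∘ suc) (0≤f ∘ suc)))

inverse-*ˡ : ∀ x (x#0 : x #0) → inverse x x#0 * x ≈ 1ℝ
inverse-*ˡ x (δ , 0<δ , away) = mk≈ (vanishing-0
  (eventually-map (λ {n} δ≤ → ≡.trans (≡.cong (ℚ._- 1ℚ) (recip-inverse {p = seq x n} 0<δ δ≤))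
                                      (ℚ.+-inverseʳ 1ℚ))
                  away))

extend : ∀ {k} {A : Subset k} → (∀ a → a ∈ A → ℝ) → Vector ℝ k
extend {A = A} f a with a ∈? A
... | yes a∈A = f a a∈A
... | no  _   = 0ℝ

sumOver : ∀ {k} (A : Subset k) → (∀ a → a ∈ A → ℝ) → ℝ
sumOver A f = sum (extend {A = A} f)

syntax sumOver A (λ a a∈A → e) = ∑[ a ∣ a∈A ∈ A ] e

module _ {k} (A : Subset k) where

  0≤sumOver : {f : ∀ a → a ∈ A → ℝ} → (∀ a a∈A → 0ℝ ≤ f a a∈A) → 0ℝ ≤ sumOver A f
  0≤sumOver {f} 0≤f = 0≤sum (extend f) 0≤extend
    where
    0≤extend : ∀ a → 0ℝ ≤ extend f a
    0≤extend a with a ∈? A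
    ... | yes a∈A = 0≤f a a∈A
    ... | no  _   = ≈⇒≤ R.refl

  sumOver-cong : {f g : ∀ a → a ∈ A → ℝ} → (∀ a a∈A → f a a∈A ≈ g a a∈A) →
                 sumOver A f ≈ sumOver A g
  sumOver-cong {f} {g} eq = sum-cong-≋ extend-cong
    where
    extend-cong : ∀ a → extend f a ≈ extend g a
    extend-cong a with a ∈? A
    ... | yes a∈A = eq a a∈A
    ... | no  _   = R.refl

  sumOver-*ˡ : ∀ c (f : ∀ a → a ∈ A → ℝ) → sumOver A (λ a a∈A → c * f a a∈A) ≈ c * sumOver A f
  sumOver-*ˡ c f = R.trans (sum-cong-≋ extend-*) (R.sym (*-distribˡ-sum c (extend f)))
    where
    extend-* : ∀ a → extend (λ a a∈A → c * f a a∈A) a ≈ c * extend f a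
    extend-* a with a ∈? A
    ... | yes a∈A = R.refl
    ... | no  _   = R.sym (R.zeroʳ c)

  sum-sumOver : ∀ {n} (f : ∀ a → a ∈ A → Vector ℝ n) →
                ∑[ t < n ] sumOver A (λ a a∈A → f a a∈A t) ≈ sumOver A (λ a a∈A → sum (f a a∈A))
  sum-sumOver {n} f = R.trans (∑-comm g) (sum-cong-≋ extend-sum)
    where
    g : Fin n → Vector ℝ k
    g t = extend (λ a a∈A → f a a∈A t)
    extend-sum : ∀ a → ∑[ t < n ] g t a ≈ extend (λ a a∈A → sum (f a a∈A)) a
    extend-sum a with a ∈? A
    ... | yes a∈A = R.refl
    ... | no  _   = sum-replicate-zero n

record Δ (n : ℕ) : Set where
  field
    prob   : Vector ℝ n
    nonneg : ∀ s → 0ℝ ≤ prob s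
    total  : sum prob ≈ 1ℝ

open Δ public

Δ-setoid : ℕ → Setoid 0ℓ 0ℓ
Δ-setoid n = On.setoid (Equality.≋-setoid ℝ-setoid n) (prob {n})

-- Reals carry a setoid equality, so functions and sets of distributions are
-- required to respect _≈Δ_ (π-cong, the Func C and I-respects below).
infix 4 _≈Δ_

_≈Δ_ : ∀ {n} → Rel (Δ n) 0ℓ
_≈Δ_ {n} = Setoid._≈_ (Δ-setoid n)

record MDP : Set where
  field
    ∣S∣ ∣Act∣ : ℕ
    Act       : Fin ∣S∣ → Subset ∣Act∣
    P         : (s : Fin ∣S∣) (a : Fin ∣Act∣) → a ∈ Act s → Δ ∣S∣

-- Only distributionally memoryless strategies: π depends on the current state
-- and the current distribution alone.
record Strategy (M : MDP) : Set where
  open MDP M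
  field
    π        : (s : Fin ∣S∣) (a : Fin ∣Act∣) → a ∈ Act s → Δ ∣S∣ → ℝ
    π-cong   : ∀ s a a∈ {μ ν} → μ ≈Δ ν → π s a a∈ μ ≈ π s a a∈ ν
    π-nonneg : ∀ s a a∈ μ → 0ℝ ≤ π s a a∈ μ
    π-total  : ∀ s μ → ∑[ a ∣ a∈ ∈ Act s ] π s a a∈ μ ≈ 1ℝ

module _ (M : MDP) (strategy : Strategy M) where
  open MDP M
  open Strategy strategy

  transform : Δ ∣S∣ → Δ ∣S∣
  transform μ = record
    { prob   = λ t → ∑[ s < ∣S∣ ] ∑[ a ∣ a∈ ∈ Act s ] (prob μ s * π s a a∈ μ * prob (P s a a∈) t)
    ; nonneg = λ t → 0≤sum _ (λ s → 0≤sumOver (Act s) (λ a a∈ →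
        0≤* (0≤* (nonneg μ s) (π-nonneg s a a∈ μ)) (nonneg (P s a a∈) t)))
    ; total  = begin
        ∑[ t < ∣S∣ ] ∑[ s < ∣S∣ ] ∑[ a ∣ a∈ ∈ Act s ] (term s a a∈ t)
          ≈⟨ ∑-comm (λ t s → ∑[ a ∣ a∈ ∈ Act s ] (term s a a∈ t)) ⟩
        ∑[ s < ∣S∣ ] ∑[ t < ∣S∣ ] ∑[ a ∣ a∈ ∈ Act s ] (term s a a∈ t)
          ≈⟨ sum-cong-≋ from-state ⟩
        sum (prob μ)
          ≈⟨ total μ ⟩
        1ℝ ∎
    }
    where
    open import Relation.Binary.Reasoning.Setoid ℝ-setoid

    term : (s : Fin ∣S∣) (a : Fin ∣Act∣) → a ∈ Act s → Fin ∣S∣ → ℝ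
    term s a a∈ t = prob μ s * π s a a∈ μ * prob (P s a a∈) t

    to-any-state : ∀ s a a∈ → sum (term s a a∈) ≈ prob μ s * π s a a∈ μ
    to-any-state s a a∈ = begin
      sum (term s a a∈)          ≈⟨ *-distribˡ-sum c (prob (P s a a∈)) ⟨
      c * sum (prob (P s a a∈))  ≈⟨ R.*-congˡ (total (P s a a∈)) ⟩
      c * 1ℝ                     ≈⟨ R.*-identityʳ c ⟩
      c                          ∎
      where c = prob μ s * π s a a∈ μ

    from-state : ∀ s → ∑[ t < ∣S∣ ] ∑[ a ∣ a∈ ∈ Act s ] (term s a a∈ t) ≈ prob μ s
    from-state s = begin
      ∑[ t < ∣S∣ ] ∑[ a ∣ a∈ ∈ Act s ] (term s a a∈ t)
        ≈⟨ sum-sumOver (Act s) (term s) ⟩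
      ∑[ a ∣ a∈ ∈ Act s ] sum (term s a a∈)
        ≈⟨ sumOver-cong (Act s) (to-any-state s) ⟩
      ∑[ a ∣ a∈ ∈ Act s ] (prob μ s * π s a a∈ μ)
        ≈⟨ sumOver-*ˡ (Act s) (prob μ s) (λ a a∈ → π s a a∈ μ) ⟩
      prob μ s * ∑[ a ∣ a∈ ∈ Act s ] π s a a∈ μ
        ≈⟨ R.*-congˡ (π-total s μ) ⟩
      prob μ s * 1ℝ
        ≈⟨ R.*-identityʳ (prob μ s) ⟩
      prob μ s ∎

  distributionAt : Δ ∣S∣ → ℕ → Δ ∣S∣
  distributionAt μ₀ zero    = μ₀
  distributionAt μ₀ (suc i) = transform (distributionAt μ₀ i)

-- Arithmetic expressions in n variables.  They denote total functions, so the
-- denominator of a quotient must be nonzero on all of ℝⁿ.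

data Expr (n : ℕ) : Set
⟦_⟧ : ∀ {n} → Expr n → Vector ℝ n → ℝ

data Expr n where
  const            : ℝ → Expr n
  var              : Fin n → Expr n
  _⊕_ _⊖_ _⊗_      : Expr n → Expr n → Expr n
  ⊝_               : Expr n → Expr n
  _⊘_given_        : (e d : Expr n) → (∀ v → ⟦ d ⟧ v #0) → Expr n

⟦ const c ⟧         v = c
⟦ var i ⟧           v = v i
⟦ e ⊕ f ⟧           v = ⟦ e ⟧ v + ⟦ f ⟧ v
⟦ e ⊖ f ⟧           v = ⟦ e ⟧ v - ⟦ f ⟧ v
⟦ e ⊗ f ⟧           v = ⟦ e ⟧ v * ⟦ f ⟧ v
⟦ ⊝ e ⟧             v = - ⟦ e ⟧ v
⟦ e ⊘ d given d≠0 ⟧ v = ⟦ e ⟧ v * inverse (⟦ d ⟧ v) (d≠0 v)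

-- The atomic proposition  exp (μ(s₁), …, μ(sₙ)) ≥ 0
infix 4 _⊨_

_⊨_ : ∀ {n} → Δ n → Expr n → Set
μ ⊨ e = 0ℝ ≤ ⟦ e ⟧ (prob μ)

record NBA (Letter : Set) : Set where
  field
    ∣Q∣ : ℕ
    δ   : Fin ∣Q∣ → Letter → Subset ∣Q∣
    q₀  : Fin ∣Q∣
    F   : Subset ∣Q∣

  Accepts : (ℕ → Letter) → Set
  Accepts σ = Σ[ run ∈ (ℕ → Fin ∣Q∣) ]
    run 0 ≡ q₀ × (∀ i → run (suc i) ∈ δ (run i) (σ i)) × (∀ i → ∃[ j ] (i ℕ.≤ j × run j ∈ F))

-- AP enumerates the finite set of atomic propositions, and 2^AP is Subset ∣AP∣.
record Specification (n : ℕ) : Set where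
  field
    ∣AP∣      : ℕ
    AP        : Fin ∣AP∣ → Expr n
    automaton : NBA (Subset ∣AP∣)

  open NBA automaton public

  infix 4 _⊨G_

  _⊨G_ : Δ n → Subset ∣AP∣ → Set
  μ ⊨G σ = (∀ p → p ∈ σ → μ ⊨ AP p) × (∀ p → p ∉ σ → ¬ (μ ⊨ AP p))

  -- { p ∈ AP ∣ μ ⊨ p }.  Inequality of reals is not decidable constructively,
  -- so excluded middle is needed to obtain a Subset.
  label : ExcludedMiddle 0ℓ → Δ n → Subset ∣AP∣
  label em μ = tabulate (λ p → does (em {μ ⊨ AP p}))

module _ (M : MDP) (strategy : Strategy M) (φ : Specification (MDP.∣S∣ M)) where
  open MDP M
  open Specification φ

  SatisfiesFrom : ExcludedMiddle 0ℓ → Δ ∣S∣ → Set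
  SatisfiesFrom em μ₀ = Accepts (λ i → label em (distributionAt M strategy μ₀ i))

  Q×Δ : Setoid 0ℓ 0ℓ
  Q×Δ = ×-setoid (≡.setoid (Fin ∣Q∣)) (Δ-setoid ∣S∣)

  record IsCertificate (Init : Pred (Δ ∣S∣) 0ℓ)
                       (𝓒 : Func Q×Δ ℝ-setoid)
                       (I : Pred (Fin ∣Q∣ × Δ ∣S∣) 0ℓ) : Set where
    C : Fin ∣Q∣ → Δ ∣S∣ → ℝ
    C q μ = Func.to 𝓒 (q , μ)

    next : Δ ∣S∣ → Δ ∣S∣
    next = transform M strategy

    field
      I-respects   : I Respects (Setoid._≈_ Q×Δ)
      initial      : ∀ μ₀ → Init μ₀ → 0ℝ ≤ C q₀ μ₀ × I (q₀ , μ₀)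
      accepting    : ∀ q → q ∈ F → ∀ σ μ → μ ⊨G σ → 0ℝ ≤ C q μ → I (q , μ) →
                     ∃[ q′ ] ( q′ ∈ δ q σ
                             × 0ℝ ≤ C q′ (next μ)
                             × I (q′ , next μ) )
      nonaccepting : ∀ q → q ∉ F → ∀ σ μ → μ ⊨G σ → 0ℝ ≤ C q μ → I (q , μ) →
                     ∃[ q′ ] ( q′ ∈ δ q σ
                             × C q′ (next μ) ≤ C q μ - 1ℝ
                             × 0ℝ ≤ C q′ (next μ)
                             × I (q′ , next μ) )

{-# OPTIONS --safe #-}

-- Acceptance of the word generated from μ by an automaton started in q depends
-- on (q , μ) alone, because the strategy is distributionally memoryless.  The accepted
-- pairs form I, and the rank of such a pair is the least time at which an accepting
-- run can visit F: following a run that attains it lowers the rank by one outside F.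
-- Conversely, a certificate lets one build a run step by step, and it visits F
-- again and again because the real-valued rank cannot drop by one forever.
module Submission where

open import Defs
open import Axiom.ExcludedMiddle using (ExcludedMiddle)
open import Data.Product.Base using (∃₂)
open import Function.Bundles using (_⇔_)
open import Level using (0ℓ)
open import Relation.Binary.Definitions using (_Respects_)
open import Relation.Unary using (Pred)

open import Algebra.Bundles using (CommutativeRing)
open import Data.Fin.Base using (Fin)
open import Data.Fin.Subset using (Subset; _∈_; _∉_)
open import Data.Fin.Subset.Properties using (_∈?_; ⊆-antisym)
import Data.Integer.Base as ℤ
import Data.Integer.Properties as ℤ
open import Data.Nat.Base as ℕ using (ℕ; zero; suc)
open import Data.Nat.Induction using (<-rec)
import Data.Nat.Properties as ℕ
open import Data.Product.Base using (Σ-syntax; ∃-syntax; _×_; _,_; proj₁; proj₂)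
open import Data.Rational.Base as ℚ using (1ℚ; ½)
open import Data.Rational.Literals using (fromℤ)
import Data.Rational.Properties as ℚ
import Data.Rational.Unnormalised.Base as ℚᵘ
import Data.Rational.Unnormalised.Properties as ℚᵘ
open import Data.Rational.Solver using (module +-*-Solver)
open import Data.Vec.Functional using (Vector)
open import Data.Vec.Properties using ([]=⇒lookup; lookup⇒[]=; lookup∘tabulate)
open import Function.Base using (_∘_)
open import Function.Bundles using (Func; mk⇔)
open import Relation.Binary.PropositionalEquality
  using (_≡_; _≗_; refl; sym; trans; cong; subst; subst₂)
open import Relation.Nullary using (¬_; Dec; yes; no; does; contradiction)
open import Relation.Nullary.Decidable using (dec-true)

open CommutativeRing ℝ-commutativeRing using (semiring)
open import Algebra.Properties.Semiring.Sum semiring using (sum-cong-≋)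

private
  module R = CommutativeRing ℝ-commutativeRing

-- Natural numbers among the reals

pointwise-≤ : ∀ {x y} → (∀ n → seq x n ℚ.≤ seq y n) → x ≤ y
pointwise-≤ {x} {y} le = mk≤ λ ε 0<ε → always λ n →
  ℚ.≤-<-trans (ℚ.≤-trans (ℚ.+-monoˡ-≤ (ℚ.- seq y n) (le n))
                         (ℚ.≤-reflexive (ℚ.+-inverseʳ (seq y n))))
              0<ε

fromℕ : ℕ → ℝ
fromℕ n = fromℚ (fromℤ (ℤ.+ n))

fromℤ-suc : ∀ n → fromℤ (ℤ.+ suc n) ≡ fromℤ (ℤ.+ n) ℚ.+ 1ℚ
-- Normalised addition does not compute for a variable `n`, so the sums are compared as unnormalised
-- fractions.
fromℤ-suc n = ℚ.toℚᵘ-injective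
  (ℚᵘ.≃-sym (ℚᵘ.≃-trans (ℚ.toℚᵘ-homo-+ (fromℤ (ℤ.+ n)) 1ℚ) (ℚᵘ.*≡* (cong (ℤ._* ℤ.+ 1) numerators))))
  where
  numerators : ℤ.+ n ℤ.* ℤ.+ 1 ℤ.+ ℤ.+ 1 ≡ ℤ.+ suc n
  numerators = trans (cong (ℤ._+ ℤ.+ 1) (ℤ.*-identityʳ (ℤ.+ n))) (ℤ.+-comm (ℤ.+ n) (ℤ.+ 1))

fromℕ-suc : ∀ n → fromℕ (suc n) - 1ℝ ≈ fromℕ n
fromℕ-suc n = pointwise λ _ →
  trans (cong (ℚ._- 1ℚ) (fromℤ-suc n)) (cancel (fromℤ (ℤ.+ n)))
  where
  open +-*-Solver
  cancel : ∀ p → p ℚ.+ 1ℚ ℚ.- 1ℚ ≡ p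
  cancel = solve 1 (λ p → p :+ con 1ℚ :- con 1ℚ := p) refl

fromℕ-mono : ∀ {m n} → m ℕ.≤ n → fromℕ m ≤ fromℕ n
fromℕ-mono m≤n = pointwise-≤ λ _ → ℚ.*≤* (ℤ.*-monoʳ-≤-nonNeg (ℤ.+ 1) (ℤ.+≤+ m≤n))

-- The absolute value of the numerator serves, since the denominator is at least 1.
bounded-by-ℕ : ∀ p → ∃[ n ] p ℚ.≤ fromℤ (ℤ.+ n)
bounded-by-ℕ p@(ℚ.mkℚ z d-1 _) = n , ℚ.≤-trans (p≤∣p∣ p)
  (ℚ.*≤* (subst₂ ℤ._≤_ (ℤ.pos-* n 1) (ℤ.pos-* n (suc d-1)) (ℤ.+≤+ (ℕ.*-monoʳ-≤ n (ℕ.s≤s ℕ.z≤n)))))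
  where n = ℤ.∣ z ∣

-- A Cauchy sequence is eventually bounded by a rational. The resulting `n` makes induction possible
-- on a real-valued rank.
archimedean : ∀ x → ∃[ n ] x ≤ fromℕ n
archimedean x = n , mk≤ λ ε 0<ε → eventually-map
    (λ {k} ∣xₖ∣≤B → ℚ.≤-<-trans
      (ℚ.≤-trans (ℚ.+-monoˡ-≤ (ℚ.- fromℤ (ℤ.+ n)) (ℚ.≤-trans (p≤∣p∣ (seq x k)) (ℚ.≤-trans ∣xₖ∣≤B B≤n)))
                 (ℚ.≤-reflexive (ℚ.+-inverseʳ (fromℤ (ℤ.+ n)))))
      0<ε)
    (proj₂ (proj₂ (seq-bounded x)))
  where
  n   = proj₁ (bounded-by-ℕ (proj₁ (seq-bounded x)))
  B≤n = proj₂ (bounded-by-ℕ (proj₁ (seq-bounded x)))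

-- Rules out a rank that drops below zero: the two sides differ by the constant `1ℚ`, which is not
-- below `½`.
0≰0-1 : ¬ (0ℝ ≤ fromℕ 0 - 1ℝ)
0≰0-1 (mk≤ le) = let (N , lt) = le ½ (ℚ.positive⁻¹ ½) in
  ℚ.<-asym (lt N ℕ.≤-refl) ½<1
  where
  ½<1 : ½ ℚ.< 1ℚ
  ½<1 = ℚ.*<* (ℤ.+<+ (ℕ.s≤s (ℕ.s≤s ℕ.z≤n)))

-- Expressions and propositions up to equality of reals

inverse-cong : ∀ {x y} (x#0 : x #0) (y#0 : y #0) → x ≈ y → inverse x x#0 ≈ inverse y y#0
-- Uniqueness of inverses in a commutative ring; no estimate on the sequences is required.
inverse-cong {x} {y} x#0 y#0 x≈y = begin
  x⁻¹              ≈⟨ R.*-identityʳ x⁻¹ ⟨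
  x⁻¹ * 1ℝ         ≈⟨ R.*-congˡ (inverse-*ˡ y y#0) ⟨
  x⁻¹ * (y⁻¹ * y)  ≈⟨ R.*-congˡ (R.*-comm y⁻¹ y) ⟩
  x⁻¹ * (y * y⁻¹)  ≈⟨ R.*-assoc x⁻¹ y y⁻¹ ⟨
  x⁻¹ * y * y⁻¹    ≈⟨ R.*-congʳ (R.*-congˡ x≈y) ⟨
  x⁻¹ * x * y⁻¹    ≈⟨ R.*-congʳ (inverse-*ˡ x x#0) ⟩
  1ℝ * y⁻¹         ≈⟨ R.*-identityˡ y⁻¹ ⟩
  y⁻¹              ∎
  where
  open import Relation.Binary.Reasoning.Setoid ℝ-setoid
  x⁻¹ = inverse x x#0
  y⁻¹ = inverse y y#0

⟦⟧-cong : ∀ {n} (e : Expr n) {v w : Vector ℝ n} → (∀ i → v i ≈ w i) → ⟦ e ⟧ v ≈ ⟦ e ⟧ w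
⟦⟧-cong (const c) eq = R.refl
⟦⟧-cong (var i)   eq = eq i
⟦⟧-cong (e ⊕ f)   eq = +-cong (⟦⟧-cong e eq) (⟦⟧-cong f eq)
⟦⟧-cong (e ⊖ f)   eq = +-cong (⟦⟧-cong e eq) (neg-cong (⟦⟧-cong f eq))
⟦⟧-cong (e ⊗ f)   eq = *-cong (⟦⟧-cong e eq) (⟦⟧-cong f eq)
⟦⟧-cong (⊝ e)     eq = neg-cong (⟦⟧-cong e eq)
⟦⟧-cong (e ⊘ d given d≠0) {v} {w} eq =
  *-cong (⟦⟧-cong e eq) (inverse-cong (d≠0 v) (d≠0 w) (⟦⟧-cong d eq))

⊨-resp : ∀ {n} (e : Expr n) {μ ν : Δ n} → μ ≈Δ ν → μ ⊨ e → ν ⊨ e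
⊨-resp e μ≈ν 0≤e = ≤-trans 0≤e (≈⇒≤ (⟦⟧-cong e μ≈ν))

-- Least natural numbers, classically

module LeastNumber (em : ExcludedMiddle 0ℓ) where

  IsLeast : Pred ℕ 0ℓ → ℕ → Set
  IsLeast P n = P n × (∀ m → P m → n ℕ.≤ m)

  -- Strong induction: `em` either yields a smaller witness or shows that `n` is least.
  ∃-least : ∀ P n → P n → ∃[ m ] IsLeast P m
  ∃-least P = <-rec (λ n → P n → ∃[ m ] IsLeast P m) step
    where
    step : ∀ n → (∀ {m} → m ℕ.< n → P m → ∃[ k ] IsLeast P k) → P n → ∃[ k ] IsLeast P k
    step n rec Pn with em {∃[ m ] (m ℕ.< n × P m)}
    ... | yes (m , m<n , Pm) = rec m<n Pm
    ... | no ∄m = n , Pn , λ m Pm → ℕ.≮⇒≥ λ m<n → ∄m (m , m<n , Pm)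

  -- The junk value 0 is taken when P is empty.
  least : Pred ℕ 0ℓ → ℕ
  least P with em {∃[ n ] P n}
  ... | yes (n , Pn) = proj₁ (∃-least P n Pn)
  ... | no _         = 0

  least-isLeast : ∀ P {n} → P n → IsLeast P (least P)
  least-isLeast P {n} Pn with em {∃[ n ] P n}
  ... | yes (m , Pm) = proj₂ (∃-least P m Pm)
  ... | no ∄P        = contradiction (n , Pn) ∄P

  -- `em` may pick different witnesses for `P` and `Q`, so the two searches are compared through
  -- minimality.
  least-cong : ∀ P Q → (∀ {n} → P n → Q n) → (∀ {n} → Q n → P n) → least P ≡ least Q
  least-cong P Q P⇒Q Q⇒P with em {∃[ n ] P n} | em {∃[ n ] Q n}
  ... | no _         | no _         = refl
  ... | yes (n , Pn) | no ∄Q        = contradiction (n , P⇒Q Pn) ∄Q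
  ... | no ∄P        | yes (n , Qn) = contradiction (n , Q⇒P Qn) ∄P
  ... | yes (n , Pn) | yes (m , Qm) =
    let (k , Pk , k≤) = ∃-least P n Pn
        (l , Ql , l≤) = ∃-least Q m Qm
    in ℕ.≤-antisym (k≤ l (Q⇒P Ql)) (l≤ k (P⇒Q Pk))

-- Accepting runs from an arbitrary state

module Runs {Letter : Set} (N : NBA Letter) where
  open NBA N

  -- At `q₀` this is `Accepts` by definition, so satisfaction from an initial distribution is
  -- already membership in `I`.
  AcceptsFrom : Fin ∣Q∣ → (ℕ → Letter) → Set
  AcceptsFrom q = NBA.Accepts (record N { q₀ = q })

  -- The run depends on `n`, so the least such `n` is optimal over all accepting runs. The run must
  -- itself be accepting so that following it stays within `I`.
  VisitsFrom : Fin ∣Q∣ → (ℕ → Letter) → ℕ → Set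
  VisitsFrom q σ n = Σ[ acc ∈ AcceptsFrom q σ ] proj₁ acc n ∈ F

  acceptsFrom-cong : ∀ {q σ τ} → σ ≗ τ → AcceptsFrom q σ → AcceptsFrom q τ
  acceptsFrom-cong σ≗τ (run , start , step , io) =
    run , start , (λ i → subst (λ a → run (suc i) ∈ δ (run i) a) (σ≗τ i) (step i)) , io

  visitsFrom-cong : ∀ {q σ τ} → σ ≗ τ → ∀ {n} → VisitsFrom q σ n → VisitsFrom q τ n
  visitsFrom-cong σ≗τ (acc , visit) = acceptsFrom-cong σ≗τ acc , visit

  ∃-visit : ∀ {q σ} → AcceptsFrom q σ → ∃[ n ] VisitsFrom q σ n
  ∃-visit acc@(_ , _ , _ , io) = let (n , _ , visit) = io 0 in n , acc , visit

  tail : ∀ {q σ} (acc : AcceptsFrom q σ) → AcceptsFrom (proj₁ acc 1) (σ ∘ suc)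
  tail (run , _ , step , io) = run ∘ suc , refl , step ∘ suc , io-tail
    where
    io-tail : ∀ i → ∃[ j ] (i ℕ.≤ j × run (suc j) ∈ F)
    -- A visit from `suc i` on has a successor index, hence a place in the shifted run.
    io-tail i with io (suc i)
    ... | suc j , ℕ.s≤s i≤j , visit = j , i≤j , visit

  first-step : ∀ {q σ} (acc : AcceptsFrom q σ) → proj₁ acc 1 ∈ δ q (σ 0)
  first-step (run , refl , step , _) = step 0

  -- A visit at time 0 would put `q` itself in `F`; a later one occurs one step earlier in the tail
  -- of the same run.
  visit-successor : ∀ {q σ n} → q ∉ F → VisitsFrom q σ n →
                    ∃[ m ] ∃[ q′ ] (n ≡ suc m × q′ ∈ δ q (σ 0) × VisitsFrom q′ (σ ∘ suc) m)
  visit-successor {n = zero}  q∉F ((_ , refl , _) , visit) = contradiction visit q∉F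
  visit-successor {n = suc m} q∉F (acc , visit) =
    m , proj₁ acc 1 , refl , first-step acc , tail acc , visit

-- The letter determined by a distribution

module Labels (em : ExcludedMiddle 0ℓ) {n} (φ : Specification n) where
  open Specification φ

  ∈-label⁻ : ∀ μ p → p ∈ label em μ → μ ⊨ AP p
  -- Abstracting `em` along with the equation makes its left side compute; a negative answer would
  -- equate `false` with `true`.
  ∈-label⁻ μ p p∈ with em {μ ⊨ AP p}
    | trans (sym (lookup∘tabulate (λ p → does (em {μ ⊨ AP p})) p)) ([]=⇒lookup p∈)
  ... | yes μ⊨p | _ = μ⊨p

  ∈-label⁺ : ∀ μ p → μ ⊨ AP p → p ∈ label em μ
  ∈-label⁺ μ p μ⊨p = lookup⇒[]= p (label em μ)
    (trans (lookup∘tabulate (λ p → does (em {μ ⊨ AP p})) p) (dec-true em μ⊨p))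

  ⊨G-label : ∀ μ → μ ⊨G label em μ
  ⊨G-label μ = ∈-label⁻ μ , λ p p∉ μ⊨p → p∉ (∈-label⁺ μ p μ⊨p)

  -- The ranking conditions range over every letter `σ`; this identifies `σ` with the one occurring
  -- in the word.
  ⊨G⇒≡label : ∀ {μ σ} → μ ⊨G σ → σ ≡ label em μ
  ⊨G⇒≡label {μ} {σ} (holds , fails) = ⊆-antisym (λ {p} p∈σ → ∈-label⁺ μ p (holds p p∈σ)) label⊆σ
    where
    label⊆σ : ∀ {p} → p ∈ label em μ → p ∈ σ
    label⊆σ {p} p∈ with p ∈? σ
    ... | yes p∈σ = p∈σ
    ... | no  p∉σ = contradiction (∈-label⁻ μ p p∈) (fails p p∉σ)

  label-cong : ∀ {μ ν} → μ ≈Δ ν → label em μ ≡ label em ν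
  label-cong {μ} {ν} μ≈ν = ⊆-antisym
    (λ {p} p∈ → ∈-label⁺ ν p (⊨-resp (AP p) {μ} {ν} μ≈ν (∈-label⁻ μ p p∈)))
    (λ {p} p∈ → ∈-label⁺ μ p (⊨-resp (AP p) {ν} {μ} (R.sym ∘ μ≈ν) (∈-label⁻ ν p p∈)))

-- Sequences of distributions

module Trajectories (M : MDP) (strategy : Strategy M) where
  open MDP M
  open Strategy strategy

  next : Δ ∣S∣ → Δ ∣S∣
  next = transform M strategy

  transform-cong : ∀ {μ ν} → μ ≈Δ ν → next μ ≈Δ next ν
  transform-cong {μ} {ν} μ≈ν t = sum-cong-≋ {x = inflow μ} {y = inflow ν} λ s →
    sumOver-cong (Act s) {flow μ s} {flow ν s} λ a a∈ →
      *-cong (*-cong (μ≈ν s) (π-cong s a a∈ {μ} {ν} μ≈ν)) (R.refl {prob (P s a a∈) t})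
    where
    flow : Δ ∣S∣ → (s : Fin ∣S∣) (a : Fin ∣Act∣) → a ∈ Act s → ℝ
    flow ξ s a a∈ = prob ξ s * π s a a∈ ξ * prob (P s a a∈) t
    inflow : Δ ∣S∣ → Vector ℝ ∣S∣
    inflow ξ s = sumOver (Act s) (flow ξ s)

  distributionAt-cong : ∀ {μ ν} → μ ≈Δ ν → ∀ i →
    distributionAt M strategy μ i ≈Δ distributionAt M strategy ν i
  distributionAt-cong         μ≈ν zero    = μ≈ν
  distributionAt-cong {μ} {ν} μ≈ν (suc i) =
    transform-cong {distributionAt M strategy μ i} {distributionAt M strategy ν i}
      (distributionAt-cong {μ} {ν} μ≈ν i)

  -- `distributionAt` adds each step at the end; moving one to the front turns the tail of a word
  -- into the word of `next μ`.
  distributionAt-next : ∀ μ i →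
    distributionAt M strategy μ (suc i) ≈Δ distributionAt M strategy (next μ) i
  distributionAt-next μ zero    = λ _ → R.refl
  distributionAt-next μ (suc i) =
    transform-cong {distributionAt M strategy μ (suc i)} {distributionAt M strategy (next μ) i}
      (distributionAt-next μ i)

-- Words and ranks of state-distribution pairs

module _ (em : ExcludedMiddle 0ℓ) (M : MDP) (π : Strategy M) (φ : Specification (MDP.∣S∣ M)) where
  open MDP M
  open Specification φ
  open LeastNumber em
  open Runs automaton
  open Labels em φ
  open Trajectories M π

  word : Δ ∣S∣ → ℕ → Subset ∣AP∣
  word μ i = label em (distributionAt M π μ i)

  word-cong : ∀ {μ ν} → μ ≈Δ ν → word μ ≗ word ν
  word-cong {μ} {ν} μ≈ν i =
    label-cong {distributionAt M π μ i} {distributionAt M π ν i} (distributionAt-cong {μ} {ν} μ≈ν i)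

  word-next : ∀ μ → word μ ∘ suc ≗ word (next μ)
  word-next μ i =
    label-cong {distributionAt M π μ (suc i)} {distributionAt M π (next μ) i} (distributionAt-next μ i)

  rank : Fin ∣Q∣ → Δ ∣S∣ → ℕ
  rank q μ = least (VisitsFrom q (word μ))

  rank-cong : ∀ q {μ ν} → μ ≈Δ ν → rank q μ ≡ rank q ν
  rank-cong q {μ} {ν} μ≈ν = least-cong (VisitsFrom q (word μ)) (VisitsFrom q (word ν))
    (visitsFrom-cong (word-cong {μ} {ν} μ≈ν)) (visitsFrom-cong (sym ∘ word-cong {μ} {ν} μ≈ν))

  -- `q′` is the second state of a run attaining the rank of `q`. The tail of that run bounds the
  -- rank of `q′`, and may not attain it.
  rank-descends : ∀ {q μ} → q ∉ F → AcceptsFrom q (word μ) →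
                  ∃[ q′ ] (q′ ∈ δ q (word μ 0) × rank q′ (next μ) ℕ.< rank q μ
                          × AcceptsFrom q′ (word (next μ)))
  rank-descends {q} {μ} q∉F acc =
    -- Acceptance gives some visit, so `least` does not return its default value here.
    let (visit , _)                     = least-isLeast (VisitsFrom q (word μ)) (proj₂ (∃-visit acc))
        (m , q′ , eq , q′∈ , visit-m)   = visit-successor q∉F visit
        visit′                          = visitsFrom-cong (word-next μ) visit-m
        (_ , least≤)                    = least-isLeast (VisitsFrom q′ (word (next μ))) visit′
    in q′ , q′∈ , subst (rank q′ (next μ) ℕ.<_) (sym eq) (ℕ.s≤s (least≤ m visit′)) , proj₁ visit′

  module _ (Init : Pred (Δ ∣S∣) 0ℓ) where

    -- From satisfaction to a certificate

    satisfies⇒certificate : (∀ μ₀ → Init μ₀ → SatisfiesFrom M π φ em μ₀) →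
                            ∃₂ λ C I → IsCertificate M π φ Init C I
    satisfies⇒certificate sat = 𝓒 , I , record
      { I-respects   = λ { {_ , μ} {_ , ν} (refl , μ≈ν) → acceptsFrom-cong (word-cong {μ} {ν} μ≈ν) }
      ; initial      = λ μ₀ μ₀∈Init → 0≤fromℕ _ , sat μ₀ μ₀∈Init
      -- The rank may rise at an accepting state, so any accepting run can be followed.
      ; accepting    = λ q _ σ μ μ⊨σ _ acc →
          proj₁ acc 1
          , subst (λ a → proj₁ acc 1 ∈ δ q a) (sym (⊨G⇒≡label {μ} {σ} μ⊨σ)) (first-step acc)
          , 0≤fromℕ _
          , acceptsFrom-cong (word-next μ) (tail acc)
      ; nonaccepting = λ q q∉F σ μ μ⊨σ _ acc →
          let (q′ , q′∈ , lt , acc′) = rank-descends q∉F acc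
          in q′ , subst (λ a → q′ ∈ δ q a) (sym (⊨G⇒≡label {μ} {σ} μ⊨σ)) q′∈ , fromℕ-< lt , 0≤fromℕ _ , acc′
      }
      where
      I : Pred (Fin ∣Q∣ × Δ ∣S∣) 0ℓ
      I (q , μ) = AcceptsFrom q (word μ)

      𝓒 : Func (Q×Δ M π φ) ℝ-setoid
      𝓒 = record
        { to   = λ (q , μ) → fromℕ (rank q μ)
        ; cong = λ { {q , μ} {_ , ν} (refl , μ≈ν) → R.reflexive (cong fromℕ (rank-cong q {μ} {ν} μ≈ν)) }
        }

      0≤fromℕ : ∀ n → 0ℝ ≤ fromℕ n
      0≤fromℕ n = fromℕ-mono {0} {n} ℕ.z≤n

      fromℕ-< : ∀ {m n} → m ℕ.< n → fromℕ m ≤ fromℕ n - 1ℝ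
      fromℕ-< {m} {suc n} (ℕ.s≤s m≤n) =
        ≤-trans (fromℕ-mono m≤n) (≈⇒≤ (R.sym (fromℕ-suc n)))

    -- From a certificate to an accepting run

    certificate⇒satisfies : (∃₂ λ C I → IsCertificate M π φ Init C I) →
                            ∀ μ₀ → Init μ₀ → SatisfiesFrom M π φ em μ₀
    certificate⇒satisfies (𝓒 , I , cert) μ₀ μ₀∈Init =
        state , refl , (λ i → proj₁ (proj₂ (step (distributionAt M π μ₀ i) (reach i)))) , visits
      where
      open IsCertificate cert using (C; initial; accepting; nonaccepting)

      Reached : Δ ∣S∣ → Set
      Reached ν = ∃[ q ] (0ℝ ≤ C q ν × I (q , ν))

      -- Requiring the descent only outside `F` gives both ranking conditions a common form.
      Successor : ∀ ν → Reached ν → Set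
      Successor ν (q , _) = Σ[ (q′ , _) ∈ Reached (transform M π ν) ]
        (q′ ∈ δ q (label em ν) × (q ∉ F → C q′ (transform M π ν) ≤ C q ν - 1ℝ))

      -- Splitting on an argument: a with-abstraction would normalise transform.
      step-by : ∀ ν (r : Reached ν) → Dec (proj₁ r ∈ F) → Successor ν r
      step-by ν (q , 0≤C , inI) (yes q∈F) =
        let (q′ , q′∈ , 0≤C′ , inI′) = accepting q q∈F (label em ν) ν (⊨G-label ν) 0≤C inI
        in (q′ , 0≤C′ , inI′) , q′∈ , contradiction q∈F
      step-by ν (q , 0≤C , inI) (no q∉F) =
        let (q′ , q′∈ , C′≤ , 0≤C′ , inI′) = nonaccepting q q∉F (label em ν) ν (⊨G-label ν) 0≤C inI
        in (q′ , 0≤C′ , inI′) , q′∈ , λ _ → C′≤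

      step : ∀ ν (r : Reached ν) → Successor ν r
      step ν r = step-by ν r (proj₁ r ∈? F)

      reach : ∀ i → Reached (distributionAt M π μ₀ i)
      reach zero    = q₀ , initial μ₀ μ₀∈Init
      reach (suc i) = proj₁ (step (distributionAt M π μ₀ i) (reach i))

      state : ℕ → Fin ∣Q∣
      state i = proj₁ (reach i)

      -- Induction on the integer bound `n`: each step outside `F` lowers the rank by one, so the
      -- bound drops with it.
      visits-within : ∀ n i → C (state i) (distributionAt M π μ₀ i) ≤ fromℕ n →
                      ∃[ j ] (i ℕ.≤ j × state j ∈ F)
      visits-within n i C≤n with state i ∈? F
      ... | yes q∈F = i , ℕ.≤-refl , q∈F
      ... | no  q∉F = continue n (≤-trans (proj₂ (proj₂ (step (distributionAt M π μ₀ i) (reach i))) q∉F)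
                                          (+-mono-≤ C≤n (≈⇒≤ (R.refl { - 1ℝ}))))
        where
        continue : ∀ n → C (state (suc i)) (distributionAt M π μ₀ (suc i)) ≤ fromℕ n - 1ℝ →
                   ∃[ j ] (i ℕ.≤ j × state j ∈ F)
        -- With the bound exhausted, the new rank would be at most -1, yet the certificate keeps it
        -- nonnegative.
        continue zero    C′≤ = contradiction (≤-trans (proj₁ (proj₂ (reach (suc i)))) C′≤) 0≰0-1
        continue (suc n) C′≤ =
          let (j , i<j , visit) = visits-within n (suc i) (≤-trans C′≤ (≈⇒≤ (fromℕ-suc n)))
          in j , ℕ.<⇒≤ i<j , visit

      visits : ∀ i → ∃[ j ] (i ℕ.≤ j × state j ∈ F)
      visits i = let (n , C≤n) = archimedean (C (state i) (distributionAt M π μ₀ i))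
                 in visits-within n i C≤n

theorem9 : (em : ExcludedMiddle 0ℓ) (M : MDP) (Init : Pred (Δ (MDP.∣S∣ M)) 0ℓ) → Init Respects _≈Δ_ → (π : Strategy M) (φ : Specification (MDP.∣S∣ M)) →
    (∀ μ₀ → Init μ₀ → SatisfiesFrom M π φ em μ₀) ⇔ (∃₂ λ C I → IsCertificate M π φ Init C I)
theorem9 em M Init _ π φ =
  mk⇔ (satisfies⇒certificate em M π φ Init) (certificate⇒satisfies em M π φ Init)
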